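{- For infinitely many positive integers $\tau$ there is an edge-colored graph $G=(V,E_{\mathrm G}\cup E_{\mathrm B}\cup E_{\mathrm W})$ with vertex cover number $\tau$ on which the vertex-cover-based recursive algorithm for Colored Arc Kayles makes at least $2^{\tau^2/2}$ recursive calls.
   Context: Colored Arc Kayles is played by two players B (black) and W (white) on a finite undirected graph $G=(V,E_{\mathrm G}\cup E_{\mathrm B}\cup E_{\mathrm W})$, with mutually disjoint sets of gray, black and white edges. On alternating turns, player B must choose an edge in $E_{\mathrm G}\cup E_{\mathrm B}$ and player W an edge in $E_{\mathrm G}\cup E_{\mathrm W}$ of the current graph; after $\{u,v\}$ is chosen the play continues on $G-u-v$. A player who cannot move loses. Put $f_{\mathrm B}(G)=1$ (resp. $f_{\mathrm W}(G)=1$) if and only if player B (resp. W) wins on $G$ when moving first. Let $c(e)\in\{\mathrm G,\mathrm B,\mathrm W\}$ be the color of an edge $e$ and $c(\{u,v\})=\emptyset$ if $\{u,v\}$ is not an edge. Let $S$ be a vertex cover of $G$. For $\mathbf x\in\{\emptyset,\mathrm G,\mathrm B,\mathrm W\}^S$ let $V_S^{(\mathbf x)}=\{v\in V\setminus S\mid c(\{v,u\})=\mathbf x[u]\ \forall u\in S\}$, and for each nonempty $V_S^{(\mathbf x)}$ fix an arbitrary representative $\rho(V_S^{(\mathbf x)})$ in it (e.g. the vertex with smallest ID). Let $E^R(S)$ be the set of all edges of $G$ of the form $\{u,\rho(V_S^{(\mathbf x)})\}$ with $u\in S$ and $\mathbf{x}\in\{\emptyset,\mathrm G,\mathrm B,\mathrm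 W\}^S$. The vertex-cover-based recursive algorithm takes a minimum vertex cover $S$ of the input graph and evaluates $f_{\mathrm B}$ and $f_{\mathrm W}$ by the recursions $$f_{\mathrm B}(G)=\bigvee_{\{u,v\}\in(E_{\mathrm G}\cup E_{\mathrm B})\cap(E^R(S)\cup S\times S)}\lnot f_{\mathrm W}(G-u-v),\qquad f_{\mathrm W}(G)=\bigvee_{\{u,v\}\in(E_{\mathrm G}\cup E_{\mathrm W})\cap(E^R(S)\cup S\times S)}\lnot f_{\mathrm B}(G-u-v),$$ where $S\times S$ stands for the pairs with both endpoints in $S$, and in the recursive call on $G-u-v$ the vertex cover used is $S\setminus\{u,v\}$. All terms of the disjunctions are evaluated; the values are memoized, so that calls on the same induced subgraph are made only once. -}

module Defs where

open import Data.Bool using (Bool; true; false; not)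
open import Data.Bool.ListAction using (or)
import Data.Bool.Properties as Bool
open import Data.Fin using (Fin)
open import Data.Fin.Properties using (all?)
open import Data.Fin.Subset using (Subset; ⊤; _∈_; _-_; ∣_∣; Nonempty)
open import Data.Fin.Subset.Properties using (_∈?_; nonempty?)
open import Data.List using (List; []; _∷_; _++_; map; filter; filterᵇ; concatMap;
  cartesianProduct; cartesianProductWith; allFin; deduplicate; length)
open import Data.Nat using (ℕ; zero; suc; _≤_)
open import Data.Product using (_×_; _,_; ∃; proj₁; proj₂)
open import Data.Sum using (_⊎_)
open import Data.Vec using (Vec; []; _∷_; lookup; tabulate)
import Data.Vec.Properties as Vec
open import Relation.Binary.Definitions using (DecidableEquality)
open import Relation.Binary.PropositionalEquality using (_≡_; _≢_; refl)
open import Relation.Nullary using (yes; no; does)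
open import Relation.Nullary.Decidable using (_×-dec_; _→-dec_; ¬?)

-- ∅ is the value of c on pairs that are not edges.
data Colour : Set where
  ∅ gray black white : Colour

_≟_ : DecidableEquality Colour
∅     ≟ ∅     = yes refl
∅     ≟ gray  = no λ ()
∅     ≟ black = no λ ()
∅     ≟ white = no λ ()
gray  ≟ ∅     = no λ ()
gray  ≟ gray  = yes refl
gray  ≟ black = no λ ()
gray  ≟ white = no λ ()
black ≟ ∅     = no λ ()
black ≟ gray  = no λ ()
black ≟ black = yes refl
black ≟ white = no λ ()
white ≟ ∅     = no λ ()
white ≟ gray  = no λ ()
white ≟ black = no λ ()
white ≟ white = yes refl

record ColouredGraph (n : ℕ) : Set where
  field
    c        : Fin n → Fin n → Colour
    c-sym    : ∀ u v → c u v ≡ c v u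
    c-irrefl : ∀ v → c v v ≡ ∅

module _ {n : ℕ} (G : ColouredGraph n) where
  open ColouredGraph G

  IsVertexCover : Subset n → Set
  IsVertexCover S = ∀ u v → c u v ≢ ∅ → u ∈ S ⊎ v ∈ S

  IsMinimumVertexCover : Subset n → Set
  IsMinimumVertexCover S = IsVertexCover S × (∀ T → IsVertexCover T → ∣ S ∣ ≤ ∣ T ∣)

  HasVertexCoverNumber : ℕ → Set
  HasVertexCoverNumber τ = ∃ λ S → IsMinimumVertexCover S × ∣ S ∣ ≡ τ

data Player : Set where
  B W : Player

opponent : Player → Player
opponent B = W
opponent W = B

mayTake : Player → Colour → Bool
mayTake B gray  = true
mayTake B black = true
mayTake W gray  = true
mayTake W white = true
mayTake _ _     = false

-- Throughout, H is the vertex set of the current induced subgraph and S the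
-- vertex cover of it that is in use; K is one of the classes V_S^(x) of that
-- subgraph.
record Representatives (n : ℕ) : Set where
  field
    ρ   : (H S K : Subset n) → Fin n
    ρ-∈ : ∀ H S K → Nonempty K → ρ H S K ∈ K

types : ∀ n → List (Vec Colour n)
types zero    = [] ∷ []
types (suc n) = cartesianProductWith _∷_ (∅ ∷ gray ∷ black ∷ white ∷ []) (types n)

elements : ∀ {n} → Subset n → List (Fin n)
elements {n} S = filter (_∈? S) (allFin n)

module _ {n : ℕ} (G : ColouredGraph n) where
  open ColouredGraph G

  -- V_S^(x).  Entries of x outside S are ignored, so that x ranging over
  -- Vec Colour n yields the same classes as x ranging over Colour^S.
  class : (H S : Subset n) → Vec Colour n → Subset n
  class H S x = tabulate λ v → does
    ((v ∈? H) ×-dec ¬? (v ∈? S) ×-dec all? λ u → (u ∈? S) →-dec (c v u ≟ lookup x u))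

  module Algorithm (R : Representatives n) where
    open Representatives R

    representatives : (H S : Subset n) → List (Fin n)
    representatives H S = map (ρ H S) (filter nonempty? (map (class H S) (types n)))

    -- E^R(S) ∪ S × S, restricted to the edges the player may choose.  The same
    -- edge may be listed repeatedly.
    branches : Player → (H S : Subset n) → List (Fin n × Fin n)
    branches p H S = filterᵇ (λ (u , v) → mayTake p (c u v))
      (cartesianProduct (elements S) (representatives H S)
        ++ cartesianProduct (elements S) (elements S))

    -- The value f_p(H), together with the list of induced subgraphs on which
    -- recursive calls occur in the recursion tree below f_p(H).  The first
    -- argument bounds the depth; as each move deletes two vertices, depth n
    -- is never exhausted before the subgraph is empty.
    evaluate : ℕ → Player → (H S : Subset n) → Bool × List (Subset n)
    evaluate zero        p H S = false , []
    evaluate (suc depth) p H S = or (map proj₁ results) , concatMap proj₂ results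
      where
      branch : Fin n × Fin n → Bool × List (Subset n)
      branch (u , v) =
        let H′          = H - u - v
            value , log = evaluate depth (opponent p) H′ (S - u - v)
        in not value , H′ ∷ log

      results : List (Bool × List (Subset n))
      results = map branch (branches p H S)

    f : Player → Subset n → Bool
    f p S = proj₁ (evaluate n p ⊤ S)

    -- With memoization, repeated calls on one induced subgraph count once.
    -- Calls f_B(H) and f_W(H) on the same H are counted together, and the two
    -- initial calls f_B(G) and f_W(G) are not counted.
    numberOfRecursiveCalls : Subset n → ℕ
    numberOfRecursiveCalls S = length (deduplicate (Vec.≡-dec Bool._≟_)
      (proj₂ (evaluate n B ⊤ S) ++ proj₂ (evaluate n W ⊤ S)))

{-# OPTIONS --safe #-}
-- Take cover vertices u_0, …, u_{τ-1} and, for every level i, all leaves that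
-- see u_i in gray and each other u_j in one of the three remaining colours (∅
-- included).  There are more than τ leaves on each level, so the u_j form the only
-- minimum vertex cover.  Delete u_{τ-1}, …, u_0 in this order, each along a gray
-- edge, so that both players may follow.  While u_0, …, u_k are left, a class that
-- is gray at u_k and not gray at u_0, …, u_{k-1} consists of leaves of level k
-- only, whichever representative it has; there are 3^k such classes.  The vertices
-- missing at the end reveal the leaf deleted on every level, hence all choices, so
-- 3^(τ(τ-1)/2) ≥ 2^(τ²/2) distinct subgraphs are reached when τ ≥ 3.
module Submission where

open import Defs
open import Data.Bool using (true; T)
import Data.Bool.Properties as Bool
open import Data.Fin using (Fin; zero; suc; toℕ; fromℕ<; inject≤; _↑ˡ_; _↑ʳ_;
  splitAt; join; combine; remQuot; finToFun; funToFin)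
import Data.Fin.Properties as Fin
open import Data.Fin.Properties using (all?)
open import Data.Fin.Subset using (Subset; ⊤; ⊥; _∈_; _∉_; _⊆_; _-_; ∣_∣; Nonempty)
open import Data.Fin.Subset.Properties using (_∈?_; nonempty?; ∈⊤; ∣⊥∣≡0;
  p─q⊆p; x∈p∧x≢y⇒x∈p-y; x∈p⇒∣p-x∣<∣p∣)
open import Data.List using (List; _∷_; length)
open import Data.List.Membership.Propositional using (lose) renaming (_∈_ to _∈ᴸ_)
open import Data.List.Membership.Propositional.Properties using (∈-map⁺; ∈-filter⁺;
  ∈-allFin; ∈-concatMap⁺; ∈-cartesianProduct⁺; ∈-cartesianProductWith⁺; ∈-++⁺ˡ;
  ∈-deduplicate⁺)
open import Data.List.Relation.Unary.Any using (here; there; index)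
open import Data.List.Membership.Setoid.Properties using (index-injective)
open import Data.Nat using (ℕ; zero; suc; _+_; _*_; _^_; _≤_; _<_; z≤n; s≤s; _<?_)
open import Data.Nat.Properties hiding (_≟_)
open import Data.Nat.Solver using (module +-*-Solver)
open import Data.Product using (Σ; ∃; _×_; _,_; proj₁; proj₂)
open import Data.Sum using (_⊎_; inj₁; inj₂; map₂)
open import Data.Vec using (Vec; []; _∷_; lookup; tabulate) renaming (_++_ to _++ᵛ_)
import Data.Vec as Vec
open import Data.Vec.Properties using (lookup∘tabulate; []=⇒lookup; lookup⇒[]=)
import Data.Vec.Properties as Vec
open import Function using (_∘_; Injective)
open import Relation.Binary.PropositionalEquality using (_≡_; _≢_; refl; sym; trans;
  cong; cong₂; subst; subst₂; setoid)
open import Relation.Nullary using (¬_; Dec; yes; no; does; contradiction)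
open import Relation.Nullary.Decidable using (_×-dec_; _→-dec_; ¬?; dec-true;
  decidable-stable)

-- Counting in subsets and lists, and digit strings.

does-true⇒ : ∀ {a} {A : Set a} (A? : Dec A) → does A? ≡ true → A
does-true⇒ (yes a) _ = a

x∉p-x : ∀ {n} (p : Subset n) x → x ∉ p - x
x∉p-x (_ ∷ p) (suc x) (Vec.there h) = x∉p-x p x h

p-x⊆p : ∀ {n} (p : Subset n) x → p - x ⊆ p
p-x⊆p p x = p─q⊆p p _

injective⇒≤∣p∣ : ∀ {m n} {g : Fin m → Fin n} (p : Subset n) →
  Injective _≡_ _≡_ g → (∀ i → g i ∈ p) → m ≤ ∣ p ∣
injective⇒≤∣p∣ {zero}      p inj g∈p = z≤n
injective⇒≤∣p∣ {suc m} {g = g} p inj g∈p = ≤-<-trans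
  (injective⇒≤∣p∣ (p - g zero) (Fin.suc-injective ∘ inj)
    λ i → x∈p∧x≢y⇒x∈p-y (g∈p (suc i)) λ eq → Fin.0≢1+n (sym (inj eq)))
  (x∈p⇒∣p-x∣<∣p∣ (g∈p zero))

∣⊤++⊥∣ : ∀ m n → ∣ ⊤ {m} ++ᵛ ⊥ {n} ∣ ≡ m
∣⊤++⊥∣ zero    n = ∣⊥∣≡0 n
∣⊤++⊥∣ (suc m) n = cong suc (∣⊤++⊥∣ m n)

↑ˡ∈⊤++ : ∀ {m n} (j : Fin m) {q : Subset n} → j ↑ˡ n ∈ ⊤ ++ᵛ q
↑ˡ∈⊤++ zero    = Vec.here
↑ˡ∈⊤++ (suc j) = Vec.there (↑ˡ∈⊤++ j)

-- Distinct elements occupy distinct indices of `xs`, since an index determines the element found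
-- there.
injective⇒≤length : ∀ {a} {A : Set a} {m} {g : Fin m → A} {xs : List A} →
  Injective _≡_ _≡_ g → (∀ i → g i ∈ᴸ xs) → m ≤ length xs
injective⇒≤length {A = A} inj g∈xs = Fin.injective⇒≤ {f = index ∘ g∈xs}
  λ {i} {j} eq → inj (index-injective (setoid A) (g∈xs i) (g∈xs j) eq)

funToFin-cong : ∀ {m n} {g h : Fin m → Fin n} → (∀ i → g i ≡ h i) →
  funToFin g ≡ funToFin h
funToFin-cong {zero}  g≗h = refl
funToFin-cong {suc m} g≗h = cong₂ combine (g≗h zero) (funToFin-cong (g≗h ∘ suc))

finToFun-injective : ∀ {m n} {s t : Fin (n ^ m)} →
  (∀ i → finToFun {n} {m} s i ≡ finToFun t i) → s ≡ t
finToFun-injective {m} {n} {s} {t} s≗t =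
  trans (sym (Fin.funToFin-finToFin {m} {n} s))
    (trans (funToFin-cong s≗t) (Fin.funToFin-finToFin {m} {n} t))

∈-types : ∀ {n} (x : Vec Colour n) → x ∈ᴸ types n
∈-types []      = here refl
∈-types (a ∷ x) = ∈-cartesianProductWith⁺ _∷_ (∈-colours a) (∈-types x)
  where
  ∈-colours : ∀ a → a ∈ᴸ ∅ ∷ gray ∷ black ∷ white ∷ List.[]
  ∈-colours ∅     = here refl
  ∈-colours gray  = there (here refl)
  ∈-colours black = there (there (here refl))
  ∈-colours white = there (there (there (here refl)))

mayTake-gray : ∀ p → mayTake p gray ≡ true
mayTake-gray B = refl
mayTake-gray W = refl

-- Classes, branches and logged calls on an arbitrary graph.

module _ {n} (G : ColouredGraph n) where
  open ColouredGraph G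

  module _ (H S : Subset n) (x : Vec Colour n) where

    inClass? : ∀ v → Dec (v ∈ H × ¬ v ∈ S × (∀ u → u ∈ S → c v u ≡ lookup x u))
    inClass? v =
      (v ∈? H) ×-dec ¬? (v ∈? S) ×-dec all? λ u → (u ∈? S) →-dec (c v u ≟ lookup x u)

    ∈-class⁺ : ∀ {v} → v ∈ H → v ∉ S → (∀ u → u ∈ S → c v u ≡ lookup x u) →
      v ∈ class G H S x
    ∈-class⁺ {v} v∈H v∉S row = lookup⇒[]= v _
      (trans (lookup∘tabulate (does ∘ inClass?) v) (dec-true (inClass? v) (v∈H , v∉S , row)))

    ∈-class⁻ : ∀ {v} → v ∈ class G H S x →
      v ∈ H × ¬ v ∈ S × (∀ u → u ∈ S → c v u ≡ lookup x u)
    ∈-class⁻ {v} v∈K = does-true⇒ (inClass? v)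
      (trans (sym (lookup∘tabulate (does ∘ inClass?) v)) ([]=⇒lookup v∈K))

  module _ (R : Representatives n) where
    open Representatives R
    open Algorithm G R

    -- The algorithm need not branch on `w` itself. This records what survives when an unknown
    -- representative replaces it: the colours towards the cover in use.
    record Twin (p : Player) (H S : Subset n) (u w : Fin n) : Set where
      field
        twin   : Fin n
        twin∈H : twin ∈ H
        same   : ∀ {u} → u ∈ S → c twin u ≡ c w u
        branch : (u , twin) ∈ᴸ branches p H S

    -- The class of the colour row of `w` contains `w`, so its representative is listed; since `u`
    -- lies in `S`, the representative sees `u` in the same colour as `w` does, and the move stays
    -- legal.
    representative : ∀ p {H S u w} → w ∈ H → w ∉ S → u ∈ S →
      mayTake p (c u w) ≡ true → Twin p H S u w
    representative p {H} {S} {u} {w} w∈H w∉S u∈S may = record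
      { twin   = v
      ; twin∈H = proj₁ v-spec
      ; same   = same
      ; branch = ∈-filter⁺ _
          (∈-++⁺ˡ (∈-cartesianProduct⁺ (∈-filter⁺ (_∈? S) (∈-allFin u) u∈S)
            (∈-map⁺ (ρ H S) (∈-filter⁺ nonempty? (∈-map⁺ (class G H S) (∈-types row)) K≢∅))))
          (subst T (sym (trans (cong (mayTake p) cuv≡cuw) may)) _)
      }
      where
      row = tabulate (c w)
      K   = class G H S row
      v   = ρ H S K

      K≢∅ : Nonempty K
      K≢∅ = w , ∈-class⁺ H S row w∈H w∉S λ u _ → sym (lookup∘tabulate (c w) u)

      v-spec = ∈-class⁻ H S row (ρ-∈ H S K K≢∅)

      same : ∀ {u} → u ∈ S → c v u ≡ c w u
      same {u} u∈S = trans (proj₂ (proj₂ v-spec) u u∈S) (lookup∘tabulate (c w) u)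

      cuv≡cuw : c u v ≡ c u w
      cuv≡cuw = trans (c-sym u v) (trans (same u∈S) (c-sym w u))

    ∈-log : ∀ {p H S u v y} d → (u , v) ∈ᴸ branches p H S →
      y ∈ᴸ (H - u - v) ∷ proj₂ (evaluate d (opponent p) (H - u - v) (S - u - v)) →
      y ∈ᴸ proj₂ (evaluate (suc d) p H S)
    ∈-log d uv∈ y∈ = ∈-concatMap⁺ proj₂ (lose (∈-map⁺ _ uv∈) y∈)

-- The graph and its colouring.

tone : Fin 3 → Colour
tone zero             = ∅
tone (suc zero)       = black
tone (suc (suc zero)) = white

-- Reserves gray for the edge from a leaf to the cover vertex of its own level, so that gray reveals
-- the level.
tone≢gray : ∀ a → tone a ≢ gray
tone≢gray zero             ()
tone≢gray (suc zero)       ()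
tone≢gray (suc (suc zero)) ()

tone-injective : ∀ {a b} → tone a ≡ tone b → a ≡ b
tone-injective {zero}           {zero}           _ = refl
tone-injective {suc zero}       {suc zero}       _ = refl
tone-injective {suc (suc zero)} {suc (suc zero)} _ = refl
tone-injective {zero}           {suc zero}       ()
tone-injective {zero}           {suc (suc zero)} ()
tone-injective {suc zero}       {suc (suc zero)} ()

-- This is 3^(k(k-1)/2), kept as a product over the levels to match the recursion of the deletions.
count : ℕ → ℕ
count zero    = 1
count (suc k) = 3 ^ k * count k

module Construction (τ : ℕ) where

  n : ℕ
  n = τ + τ * 3 ^ τ

  cover : Fin τ → Fin n
  cover j = j ↑ˡ τ * 3 ^ τ

  -- The base-3 digits of x are the colours towards the cover vertices; digit i
  -- is redundant, which makes three copies of every leaf.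
  leaf : Fin τ → Fin (3 ^ τ) → Fin n
  leaf i x = τ ↑ʳ combine i x

  data View : Fin n → Set where
    cover′ : ∀ j → View (cover j)
    leaf′  : ∀ i x → View (leaf i x)

  view : ∀ v → View v
  view v = subst View (Fin.join-splitAt τ _ v) (view-join (splitAt τ v))
    where
    view-join : ∀ s → View (join τ _ s)
    view-join (inj₁ j) = cover′ j
    view-join (inj₂ y) = subst (View ∘ (τ ↑ʳ_)) (Fin.combine-remQuot {τ} (3 ^ τ) y)
      (leaf′ _ _)

  decode : Fin n → Fin τ ⊎ (Fin τ × Fin (3 ^ τ))
  decode v = map₂ (remQuot {τ} (3 ^ τ)) (splitAt τ v)

  decode-cover : ∀ j → decode (cover j) ≡ inj₁ j
  decode-cover j = cong (map₂ _) (Fin.splitAt-↑ˡ τ j _)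

  decode-leaf : ∀ i x → decode (leaf i x) ≡ inj₂ (i , x)
  decode-leaf i x = trans (cong (map₂ _) (Fin.splitAt-↑ʳ τ _ (combine i x)))
    (cong inj₂ (Fin.remQuot-combine i x))

  cover≢leaf : ∀ {j i x} → cover j ≢ leaf i x
  cover≢leaf {j} {i} {x} eq
    with () ← trans (sym (decode-cover j)) (trans (cong decode eq) (decode-leaf i x))

  leaf-injective : ∀ {i x i′ x′} → leaf i x ≡ leaf i′ x′ → i ≡ i′ × x ≡ x′
  leaf-injective {i} {x} {i′} {x′} eq
    with refl ← trans (sym (decode-leaf i x)) (trans (cong decode eq) (decode-leaf i′ x′))
    = refl , refl

  edge : Fin τ → Fin τ → Fin (3 ^ τ) → Colour
  edge j i x with j Fin.≟ i
  ... | yes _ = gray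
  ... | no  _ = tone (finToFun x j)

  edge-gray : ∀ i x → edge i i x ≡ gray
  edge-gray i x with i Fin.≟ i
  ... | yes _  = refl
  ... | no i≢i = contradiction refl i≢i

  edge-gray⁻ : ∀ {j i x} → edge j i x ≡ gray → j ≡ i
  edge-gray⁻ {j} {i} {x} eq with j Fin.≟ i
  ... | yes j≡i = j≡i
  ... | no  _   = contradiction eq (tone≢gray (finToFun x j))

  edge-tone : ∀ {j i} x → j ≢ i → edge j i x ≡ tone (finToFun x j)
  edge-tone {j} {i} x j≢i with j Fin.≟ i
  ... | yes j≡i = contradiction j≡i j≢i
  ... | no  _   = refl

  colour : (s t : Fin τ ⊎ (Fin τ × Fin (3 ^ τ))) → Colour
  colour (inj₁ j)       (inj₂ (i , x)) = edge j i x
  colour (inj₂ (i , x)) (inj₁ j)       = edge j i x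
  colour (inj₁ _)       (inj₁ _)       = ∅
  colour (inj₂ _)       (inj₂ _)       = ∅

  colour-sym : ∀ s t → colour s t ≡ colour t s
  colour-sym (inj₁ _) (inj₁ _) = refl
  colour-sym (inj₁ _) (inj₂ _) = refl
  colour-sym (inj₂ _) (inj₁ _) = refl
  colour-sym (inj₂ _) (inj₂ _) = refl

  colour-irrefl : ∀ s → colour s s ≡ ∅
  colour-irrefl (inj₁ _) = refl
  colour-irrefl (inj₂ _) = refl

  G : ColouredGraph n
  G = record
    { c        = λ u v → colour (decode u) (decode v)
    ; c-sym    = λ u v → colour-sym (decode u) (decode v)
    ; c-irrefl = λ v → colour-irrefl (decode v)
    }

  open ColouredGraph G

  c-cover-cover : ∀ i j → c (cover i) (cover j) ≡ ∅
  c-cover-cover i j = cong₂ colour (decode-cover i) (decode-cover j)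

  c-cover-leaf : ∀ j i x → c (cover j) (leaf i x) ≡ edge j i x
  c-cover-leaf j i x = cong₂ colour (decode-cover j) (decode-leaf i x)

  c-leaf-cover : ∀ i x j → c (leaf i x) (cover j) ≡ edge j i x
  c-leaf-cover i x j = cong₂ colour (decode-leaf i x) (decode-cover j)

  c-leaf-leaf : ∀ i x i′ x′ → c (leaf i x) (leaf i′ x′) ≡ ∅
  c-leaf-leaf i x i′ x′ = cong₂ colour (decode-leaf i x) (decode-leaf i′ x′)

  -- Vertex covers and how deletions change them.

  covers⊆⇒τ≤ : ∀ T → (∀ j → cover j ∈ T) → τ ≤ ∣ T ∣
  covers⊆⇒τ≤ T = injective⇒≤∣p∣ T (Fin.↑ˡ-injective _ _ _)

  -- If `cover j` is missing, the gray edges at it force all 3^τ leaves of level `j` into `T`.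
  vertexCover-dichotomy : ∀ T → IsVertexCover G T →
    (∀ j → cover j ∈ T) ⊎ 3 ^ τ ≤ ∣ T ∣
  vertexCover-dichotomy T T-cover with all? (λ j → cover j ∈? T)
  ... | yes all∈T = inj₁ all∈T
  ... | no ¬all∈T with j , j∉T ← Fin.¬∀⟶∃¬ τ _ (λ j → cover j ∈? T) ¬all∈T
    = inj₂ (injective⇒≤∣p∣ T (proj₂ ∘ leaf-injective {j} {_} {j}) leaf∈T)
    where
    gray≢∅ : ∀ {a} → a ≡ gray → a ≢ ∅
    gray≢∅ refl ()

    leaf∈T : ∀ x → leaf j x ∈ T
    leaf∈T x with T-cover (cover j) (leaf j x)
      (gray≢∅ (trans (c-cover-leaf j j x) (edge-gray j x)))
    ... | inj₁ j∈T = contradiction j∈T j∉T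
    ... | inj₂ x∈T = x∈T

  n<3^n : ∀ m → m < 3 ^ m
  n<3^n zero    = s≤s z≤n
  n<3^n (suc m) = ≤-trans (+-mono-≤ {1} (m^n>0 3 m) (n<3^n m))
    (+-monoʳ-≤ (3 ^ m) (m≤m+n (3 ^ m) (1 * 3 ^ m)))

  U : Subset n
  U = ⊤ {τ} ++ᵛ ⊥

  U-vertexCover : IsVertexCover G U
  U-vertexCover u v c≢∅ with view u | view v
  ... | cover′ j  | _         = inj₁ (↑ˡ∈⊤++ j)
  ... | leaf′ _ _ | cover′ j  = inj₂ (↑ˡ∈⊤++ j)
  ... | leaf′ i x | leaf′ j y = contradiction (c-leaf-leaf i x j y) c≢∅

  U-minimum : IsMinimumVertexCover G U
  U-minimum = U-vertexCover , λ T T-cover → subst (_≤ ∣ T ∣) (sym (∣⊤++⊥∣ τ _)) (τ≤ T T-cover)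
    where
    τ≤ : ∀ T → IsVertexCover G T → τ ≤ ∣ T ∣
    τ≤ T T-cover with vertexCover-dichotomy T T-cover
    ... | inj₁ all∈T = covers⊆⇒τ≤ T all∈T
    ... | inj₂ large = ≤-trans (<⇒≤ (n<3^n τ)) large

  -- Invariant of the cover in use: once the higher cover vertices are deleted, exactly u_0, ...,
  -- u_{k-1} remain.
  record CoversBelow (k : ℕ) (S : Subset n) : Set where
    field
      below∈ : ∀ {j} → toℕ j < k → cover j ∈ S
      ∈below : ∀ {v} → v ∈ S → ∃ λ j → toℕ j < k × v ≡ cover j

  open CoversBelow

  minimum⇒CoversBelow : ∀ {S} → IsMinimumVertexCover G S → CoversBelow τ S
  minimum⇒CoversBelow {S} (S-cover , S-min) with vertexCover-dichotomy S S-cover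
  ... | inj₂ large = contradiction (≤-trans large ∣S∣≤τ) (<⇒≱ (n<3^n τ))
    where
    ∣S∣≤τ : ∣ S ∣ ≤ τ
    ∣S∣≤τ = subst (∣ S ∣ ≤_) (∣⊤++⊥∣ τ _) (S-min U U-vertexCover)
  ... | inj₁ all∈S = record { below∈ = λ _ → all∈S _ ; ∈below = only }
    where
    only : ∀ {v} → v ∈ S → ∃ λ j → toℕ j < τ × v ≡ cover j
    only {v} v∈S with view v
    ... | cover′ j  = j , Fin.toℕ<n j , refl
    -- Removing this leaf would still leave all τ cover vertices, so `S` would have more than τ
    -- elements.
    ... | leaf′ i x = contradiction
      (≤-trans (S-min U U-vertexCover) (≤-reflexive (∣⊤++⊥∣ τ _)))
      (<⇒≱ (≤-<-trans
        (covers⊆⇒τ≤ (S - leaf i x) λ j → x∈p∧x≢y⇒x∈p-y (all∈S j) cover≢leaf)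
        (x∈p⇒∣p-x∣<∣p∣ v∈S)))

  CoversBelow-delete : ∀ {k S κ i x} → toℕ κ ≡ k → CoversBelow (suc k) S →
    CoversBelow k (S - cover κ - leaf i x)
  CoversBelow-delete {S = S} {κ} {i} {x} refl CB = record
    { below∈ = λ j<k → x∈p∧x≢y⇒x∈p-y
        (x∈p∧x≢y⇒x∈p-y (below∈ CB (m<n⇒m<1+n j<k))
          λ eq → <⇒≢ j<k (cong toℕ (Fin.↑ˡ-injective _ _ _ eq)))
        cover≢leaf
    ; ∈below = shrink
    }
    where
    shrink : ∀ {v} → v ∈ S - cover κ - leaf i x → ∃ λ j → toℕ j < toℕ κ × v ≡ cover j
    shrink v∈ with v∈S-κ ← p-x⊆p (S - cover κ) (leaf i x) v∈
      with ∈below CB (p-x⊆p S (cover κ) v∈S-κ)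
    ... | j , j<1+k , refl = j , ≤∧≢⇒< (m<1+n⇒m≤n j<1+k) j≢κ , refl
      where
      j≢κ : toℕ j ≢ toℕ κ
      j≢κ eq with refl ← Fin.toℕ-injective eq = x∉p-x S (cover κ) v∈S-κ

  -- Distinct subgraphs reached by the deletions.

  digits : ∀ k → Fin (3 ^ k) → Fin τ → Fin 3
  digits k t j with toℕ j <? k
  ... | yes j<k = finToFun t (fromℕ< j<k)
  -- A filler: on level `k`, entry `k` is overridden by gray, and later entries concern cover
  -- vertices already deleted.
  ... | no  _   = zero

  digits-< : ∀ {k} t {j} (j<k : toℕ j < k) → digits k t j ≡ finToFun t (fromℕ< j<k)
  digits-< {k} t {j} j<k with toℕ j <? k
  ... | yes _  = refl
  ... | no j≮k = contradiction j<k j≮k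

  digits-injective : ∀ {k} → k ≤ τ → {s t : Fin (3 ^ k)} →
    (∀ {j} → toℕ j < k → digits k s j ≡ digits k t j) → s ≡ t
  digits-injective {k} k≤τ {s} {t} eq = finToFun-injective λ i →
    subst (λ i → finToFun s i ≡ finToFun t i) (back i)
      (trans (sym (digits-< s (small i))) (trans (eq (small i)) (digits-< t (small i))))
    where
    small : ∀ i → toℕ (inject≤ i k≤τ) < k
    small i = subst (_< k) (sym (Fin.toℕ-inject≤ i k≤τ)) (Fin.toℕ<n i)

    back : ∀ i → fromℕ< (small i) ≡ i
    back i = Fin.toℕ-injective (trans (Fin.toℕ-fromℕ< (small i)) (Fin.toℕ-inject≤ i k≤τ))

  -- `keeps` says that the deletions leading to a position spare all levels from `k` on; this is
  -- what lets the leaf deleted on level `k` be read off afterwards.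
  record Positions (m k : ℕ) (H : Subset n) (L : List (Subset n)) : Set where
    field
      position : Fin m → Subset n
      distinct : Injective _≡_ _≡_ position
      logged   : ∀ a → position a ∈ᴸ L
      shrinks  : ∀ a → position a ⊆ H
      keeps    : ∀ a {i x} → k ≤ toℕ i → leaf i x ∈ H → leaf i x ∈ position a

  module _ (R : Representatives n) where
    open Algorithm G R

    play : ∀ k d p {H S} → k ≤ τ → k ≤ d → CoversBelow k S →
      (∀ {i x} → toℕ i < k → leaf i x ∈ H) →
      Positions (count k) k H (H ∷ proj₂ (evaluate d p H S))

    move : ∀ k d p {H S} → k < τ → k ≤ d → CoversBelow (suc k) S →
      (∀ {i x} → toℕ i < suc k → leaf i x ∈ H) →
      Positions (count (suc k)) (suc k) H (proj₂ (evaluate (suc d) p H S))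

    play zero d p {H} _ _ CB leaves = record
      { position = λ _ → H
      ; distinct = λ { {zero} {zero} _ → refl }
      ; logged   = λ _ → here refl
      ; shrinks  = λ _ v∈H → v∈H
      ; keeps    = λ _ _ v∈H → v∈H
      }
    play (suc k) (suc d) p k<τ (s≤s k≤d) CB leaves = record
      { position = position
      ; distinct = distinct
      ; logged   = there ∘ logged
      ; shrinks  = shrinks
      ; keeps    = keeps
      }
      where open Positions (move k d p k<τ k≤d CB leaves)

    move k d p {H} {S} k<τ k≤d CB leaves = record
      -- An index encodes the digit string chosen now together with an index among the positions
      -- after that choice.
      { position = pos ∘ remQuot {3 ^ k} (count k)
      ; distinct = λ {a} {b} eq → trans (sym (Fin.combine-remQuot {3 ^ k} (count k) a))
          (trans (cong (λ (t , a) → combine t a) (pos-injective eq))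
            (Fin.combine-remQuot {3 ^ k} (count k) b))
      ; logged   = λ a → let t , a = remQuot {3 ^ k} (count k) a in
          ∈-log G R d (Twin.branch (choice t)) (Positions.logged (after t) a)
      ; shrinks  = λ a → let t , a = remQuot {3 ^ k} (count k) a in
          λ v∈ → p-x⊆p H (cover κ) (p-x⊆p (H - cover κ) (v t) (Positions.shrinks (after t) a v∈))
      ; keeps    = λ a k<i l∈H → let t , a = remQuot {3 ^ k} (count k) a in
          -- The leaf deleted now is on level `k`, hence differs from any leaf on a higher level.
          Positions.keeps (after t) a (<⇒≤ k<i) (survives t l∈H λ eq → <⇒≢ k<i
            (trans (sym κ≡k) (cong toℕ (sym (proj₁ (leaf-injective (trans eq (v≡leaf t))))))))
      }
      where
      κ : Fin τ
      κ = fromℕ< k<τ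

      κ≡k : toℕ κ ≡ k
      κ≡k = Fin.toℕ-fromℕ< k<τ

      κ∈S : cover κ ∈ S
      κ∈S = below∈ CB (≤-reflexive (cong suc κ≡k))

      model : Fin (3 ^ k) → Fin (3 ^ τ)
      model t = funToFin (digits k t)

      choice : ∀ t → Twin G R p H S (cover κ) (leaf κ (model t))
      choice t = representative G R p (leaves (≤-reflexive (cong suc κ≡k)))
        (λ l∈S → let _ , _ , eq = ∈below CB l∈S in cover≢leaf (sym eq)) κ∈S
        (trans (cong (mayTake p) (trans (c-cover-leaf κ κ (model t)) (edge-gray κ (model t))))
          (mayTake-gray p))

      v : Fin (3 ^ k) → Fin n
      v t = Twin.twin (choice t)

      -- Like the model leaf, the representative is gray at u_k. Cover vertices are not adjacent to
      -- u_k, and only leaves of level `k` are gray there.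
      v-leaf : ∀ t → ∃ λ x → v t ≡ leaf κ x
      v-leaf t = go (view (v t)) (trans (Twin.same (choice t) κ∈S)
        (trans (c-leaf-cover κ (model t) κ) (edge-gray κ (model t))))
        where
        go : ∀ {v} → View v → c v (cover κ) ≡ gray → ∃ λ x → v ≡ leaf κ x
        go (cover′ j)  eq with () ← trans (sym (c-cover-cover j κ)) eq
        go (leaf′ i x) eq
          with refl ← edge-gray⁻ {κ} {i} {x} (trans (sym (c-leaf-cover i x κ)) eq) = x , refl

      v≡leaf : ∀ t → v t ≡ leaf κ (proj₁ (v-leaf t))
      v≡leaf t = proj₂ (v-leaf t)

      -- The colours of `v t` towards u_0, ..., u_{k-1} spell out the digits of `t`, whichever
      -- representative was taken.
      v-injective : ∀ {s t} → v s ≡ v t → s ≡ t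
      v-injective {s} {t} eq = digits-injective (<⇒≤ k<τ) λ {j} j<k →
        tone-injective (trans (sym (row s j<k)) (trans (cong (λ v → c v (cover j)) eq) (row t j<k)))
        where
        row : ∀ t {j} → toℕ j < k → c (v t) (cover j) ≡ tone (digits k t j)
        row t {j} j<k = trans (Twin.same (choice t) (below∈ CB (m<n⇒m<1+n j<k)))
          (trans (c-leaf-cover κ (model t) j)
            (trans (edge-tone (model t) λ j≡κ → <⇒≢ j<k (trans (cong toℕ j≡κ) κ≡k))
              (cong tone (Fin.finToFun-funToFin (digits k t) j))))

      survives : ∀ t {i x} → leaf i x ∈ H → leaf i x ≢ v t → leaf i x ∈ H - cover κ - v t
      survives t l∈H = x∈p∧x≢y⇒x∈p-y (x∈p∧x≢y⇒x∈p-y l∈H (cover≢leaf ∘ sym))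

      after : ∀ t → Positions (count k) k (H - cover κ - v t)
        ((H - cover κ - v t) ∷
          proj₂ (evaluate d (opponent p) (H - cover κ - v t) (S - cover κ - v t)))
      after t = play k d (opponent p) (<⇒≤ k<τ) k≤d
        (subst (λ v → CoversBelow k (S - cover κ - v)) (sym (v≡leaf t))
          (CoversBelow-delete κ≡k CB))
        λ i<k → survives t (leaves (m<n⇒m<1+n i<k)) λ eq → <⇒≢ i<k
          (trans (cong toℕ (proj₁ (leaf-injective (trans eq (v≡leaf t))))) κ≡k)

      pos : Fin (3 ^ k) × Fin (count k) → Subset n
      pos (t , a) = Positions.position (after t) a

      -- If `s` and `t` differed, `v s` would be absent from every position after choice `s` but
      -- present in every one after `t`, where only `v t` is lost from level `k`.
      choice-determined : ∀ {s t} a b → pos (s , a) ≡ pos (t , b) → s ≡ t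
      choice-determined {s} {t} a b eq = decidable-stable (s Fin.≟ t) λ s≢t →
        x∉p-x (H - cover κ) (v s) (Positions.shrinks (after s) a
          (subst₂ _∈_ (sym (v≡leaf s)) (sym eq)
            (Positions.keeps (after t) b (≤-reflexive (sym κ≡k))
              (survives t (subst (_∈ H) (v≡leaf s) (Twin.twin∈H (choice s)))
                λ leaf≡vt → s≢t (v-injective (trans (v≡leaf s) leaf≡vt))))))

      pos-injective′ : ∀ {s t a b} → s ≡ t → pos (s , a) ≡ pos (t , b) → (s , a) ≡ (t , b)
      pos-injective′ {s} refl eq = cong (s ,_) (Positions.distinct (after s) eq)

      pos-injective : ∀ {q r} → pos q ≡ pos r → q ≡ r
      pos-injective {s , a} {t , b} eq = pos-injective′ (choice-determined a b eq) eq

    -- The initial call is not logged, so the count starts with `move` and not with `play`. The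
    -- recursion tree in which B moves first already supplies all positions.
    count≤calls : ∀ {d S} → τ ≡ suc d → IsMinimumVertexCover G S →
      count τ ≤ numberOfRecursiveCalls S
    count≤calls {d} {S} refl S-min = injective⇒≤length distinct λ a →
      ∈-deduplicate⁺ (Vec.≡-dec Bool._≟_) (∈-++⁺ˡ (logged a))
      where
      open Positions (move d _ B {⊤} {S} ≤-refl (m≤m+n d _)
        (minimum⇒CoversBelow S-min) λ _ → ∈⊤)

-- Comparing 3^(τ(τ-1)/2) with 2^(τ²/2).

2*4^k≤9^k : ∀ k → 2 * 4 ^ suc k ≤ 9 ^ suc k
2*4^k≤9^k zero    = m≤m+n 8 1
2*4^k≤9^k (suc k) = begin
  2 * (4 * 4 ^ suc k) ≡⟨ solve 1 (λ x → con 2 :* (con 4 :* x) := con 4 :* (con 2 :* x)) refl (4 ^ suc k) ⟩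
  4 * (2 * 4 ^ suc k) ≤⟨ *-mono-≤ (m≤m+n 4 5) (2*4^k≤9^k k) ⟩
  9 * 9 ^ suc k       ∎
  where
  open ≤-Reasoning
  open +-*-Solver

-- Squaring avoids the half in the exponent. Passing from τ to τ + 1 multiplies the left side by 2 ·
-- 4^τ and the right side by 9^τ.
2^τ²≤count² : ∀ N → 2 ^ ((3 + N) * (3 + N)) ≤ count (3 + N) ^ 2
-- Here 512 ≤ 729, with difference 217; for τ = 2 the bound would read 16 ≤ 9.
2^τ²≤count² zero    = m≤m+n (2 ^ 9) 217
2^τ²≤count² (suc N) = begin
  2 ^ (suc τ * suc τ)           ≡⟨ cong (2 ^_) (solve 1 (λ t → (con 1 :+ t) :* (con 1 :+ t) := con 1 :+ con 2 :* t :+ t :* t) refl τ) ⟩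
  2 ^ (suc (2 * τ) + τ * τ)     ≡⟨ ^-distribˡ-+-* 2 (suc (2 * τ)) (τ * τ) ⟩
  2 * 2 ^ (2 * τ) * 2 ^ (τ * τ) ≡⟨ cong (λ x → 2 * x * 2 ^ (τ * τ)) (sym (^-*-assoc 2 2 τ)) ⟩
  2 * 4 ^ τ * 2 ^ (τ * τ)       ≤⟨ *-mono-≤ (2*4^k≤9^k (2 + N)) (2^τ²≤count² N) ⟩
  9 ^ τ * count τ ^ 2           ≡⟨ cong (_* count τ ^ 2) (trans (^-*-assoc 3 2 τ) (trans (cong (3 ^_) (*-comm 2 τ)) (sym (^-*-assoc 3 τ 2)))) ⟩
  (3 ^ τ) ^ 2 * count τ ^ 2     ≡⟨ solve 2 (λ x y → (x :* (x :* con 1)) :* (y :* (y :* con 1)) := (x :* y) :* ((x :* y) :* con 1)) refl (3 ^ τ) (count τ) ⟩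
  (3 ^ τ * count τ) ^ 2         ∎
  where
  τ = 3 + N
  open ≤-Reasoning
  open +-*-Solver

theorem3 : ∀ (N : ℕ) → ∃ λ (τ : ℕ) → N < τ ×
    ∃ λ (n : ℕ) → Σ (ColouredGraph n) λ G →
    HasVertexCoverNumber G τ ×
    (∀ (S : Subset n) → IsMinimumVertexCover G S → ∀ (R : Representatives n) →
    2 ^ (τ * τ) ≤ (Algorithm.numberOfRecursiveCalls G R S) ^ 2)
theorem3 N = 3 + N , m≤n+m (suc N) 2 , n , G , (U , U-minimum , ∣⊤++⊥∣ (3 + N) _) ,
  λ S S-min R → ≤-trans (2^τ²≤count² N) (^-monoˡ-≤ 2 (count≤calls R refl S-min))
  where open Construction (3 + N)
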